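{- Let $X\subset A^+$ be a thin maximal bifix code and let $x\in A^{\mathbb N}$ be an $X$-stable infinite word. If $\mathrm{Card}(X\cap F(x))\le d_{F(x)}(X)$, then $x$ is ultimately periodic.
   Context: $A$ is a finite alphabet. A bifix code is a set of nonempty words none of which is a proper prefix or proper suffix of another; a maximal bifix code is one not properly contained in another bifix code of $A^*$; it is thin if some word of $A^*$ is not a factor of any of its words. For an infinite word $y$, $F(y)$ is its set of finite factors. A parse of $w$ with respect to $X$ is a triple $(v,z,u)$ with $w=vzu$, $v$ having no suffix in $X$, $z\in X^*$, $u$ having no prefix in $X$; $\delta_X(w)$ is their number, and $d_{F(y)}(X)=\max_{w\in F(y)}\delta_X(w)$. An infinite word $x$ is $X$-stable if $d_{F(y)}(X)=d_{F(x)}(X)$ for every suffix $y$ of $x$ (i.e. every $y$ with $x=uy$, $u\in A^*$). $x=a_0a_1\cdots$ is ultimately periodic if there is $n\ge1$ with $a_{i+n}=a_i$ for all sufficiently large $i$. -}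

module Defs where

open import Data.List using (List; []; _∷_; _++_; length; concat)
open import Data.List.Membership.Propositional using (_∈_)
open import Data.List.Relation.Binary.Infix.Heterogeneous using (Infix)
open import Data.List.Relation.Binary.Prefix.Heterogeneous using (Prefix)
open import Data.List.Relation.Binary.Suffix.Heterogeneous using (Suffix)
open import Data.List.Relation.Unary.All using (All)
open import Data.List.Relation.Unary.Unique.Propositional using (Unique)
open import Data.Nat using (ℕ; zero; suc; _+_; _≤_)
open import Data.Product using (∃-syntax; _×_; _,_)
open import Function.Bundles using (_⇔_)
open import Level using (0ℓ)
open import Relation.Binary.PropositionalEquality using (_≡_; _≢_; _≗_)
open import Relation.Nullary using (¬_)
open import Relation.Unary using (Pred; _⊄_)

Word : Set → Set
Word A = List A

Language : Set → Set₁
Language A = Pred (Word A) 0ℓ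

InfWord : Set → Set
InfWord A = ℕ → A

-- Infinite words are compared pointwise (_≗_) throughout, since function
-- extensionality is not available.

infixr 5 _++ω_

_++ω_ : {A : Set} → Word A → InfWord A → InfWord A
([]      ++ω y) i       = y i
((a ∷ u) ++ω y) zero    = a
((a ∷ u) ++ω y) (suc i) = (u ++ω y) i

module _ {A : Set} where

  IsPrefix IsSuffix IsFactor : Word A → Word A → Set
  IsPrefix = Prefix _≡_
  IsSuffix = Suffix _≡_
  IsFactor = Infix _≡_

  IsProperPrefix IsProperSuffix : Word A → Word A → Set
  IsProperPrefix u v = IsPrefix u v × u ≢ v
  IsProperSuffix u v = IsSuffix u v × u ≢ v

  record IsBifixCode (X : Language A) : Set where
    field
      nonempty : ∀ {w} → X w → w ≢ []
      prefix   : ∀ {u v} → X u → X v → ¬ IsProperPrefix u v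
      suffix   : ∀ {u v} → X u → X v → ¬ IsProperSuffix u v

  record IsMaximalBifixCode (X : Language A) : Set₁ where
    field
      isBifixCode : IsBifixCode X
      maximal     : ∀ (Y : Language A) → IsBifixCode Y → X ⊄ Y

  IsThin : Language A → Set
  IsThin X = ∃[ w ] (∀ {v} → X v → ¬ IsFactor w v)

  F : InfWord A → Language A
  F y w = ∃[ u ] ∃[ y′ ] y ≗ u ++ω w ++ω y′

  Star : Language A → Language A
  Star X z = ∃[ ws ] All X ws × concat ws ≡ z

  IsParse : Language A → Word A → Pred (Word A × Word A × Word A) 0ℓ
  IsParse X w (v , z , u) =
      w ≡ v ++ z ++ u
    × (∀ {s} → IsSuffix s v → ¬ X s)
    × Star X z
    × (∀ {p} → IsPrefix p u → ¬ X p)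

HasCard : {B : Set} → Pred B 0ℓ → ℕ → Set
HasCard S n = ∃[ bs ] Unique bs × length bs ≡ n × (∀ b → b ∈ bs ⇔ S b)

Card≤ : {B : Set} → Pred B 0ℓ → ℕ → Set
Card≤ S d = ∃[ n ] HasCard S n × n ≤ d

module _ {A : Set} where

  -- δ X w m  means  δ_X(w) = m.
  δ : Language A → Word A → ℕ → Set
  δ X w = HasCard (IsParse X w)

  -- IsDegree X G d  means  d_G(X) = d, the maximum of δ_X over G.
  IsDegree : Language A → Language A → ℕ → Set
  IsDegree X G d =
      (∃[ w ] G w × δ X w d)
    × (∀ {w m} → G w → δ X w m → m ≤ d)

  -- d_{F(y)}(X) = d_{F(x)}(X) for every suffix y of x; an equivalence of
  -- graphs, so that no existence of the maximum is presupposed.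
  IsStable : Language A → InfWord A → Set
  IsStable X x =
    ∀ (u : Word A) (y : InfWord A) → x ≗ u ++ω y →
    ∀ d → IsDegree X (F y) d ⇔ IsDegree X (F x) d

  IsUltimatelyPeriodic : InfWord A → Set
  IsUltimatelyPeriodic x =
    ∃[ n ] 1 ≤ n × (∃[ N ] (∀ i → N ≤ i → x (i + n) ≡ x i))

{-# OPTIONS --safe #-}

-- A parse of w is determined by its left component, so δ_X(w) is the number of prefixes of w
-- without a suffix in X. Hence, after a factor of x with the maximal number d of parses, every
-- position is the end of an occurrence of a word of X, and by stability every later cut j of x is
-- touched by d + 1 such occurrences (start ≤ j ≤ end) with distinct ends. As X ∩ F(x) has at most
-- d words, two of these occurrences carry the same word, which yields a square of bounded period
-- centred at j. By the critical factorization theorem, applied to longer and longer windows of x,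
-- x is then ultimately periodic.

module Submission where

open import Defs
open import Data.Fin using (Fin)
import Data.Fin as Fin
import Data.Fin.Properties as Fin
open import Data.List using (List; []; _∷_; _++_; length; concat; filter; lookup; map; upTo)
open import Data.List.Extrema.Nat using (max; xs≤max)
open import Data.List.Membership.DecPropositional using (_∈?_)
open import Data.List.Membership.Propositional using (_∈_)
open import Data.List.Membership.Propositional.Properties
  using (∈-++⁺ˡ; ∈-++⁺ʳ; ∈-++⁻; ∈-filter⁺; ∈-filter⁻; ∈-lookup; ∈-map⁺; ∈-map⁻; ∈-upTo⁺; ∈-upTo⁻; ∈-∃++)
open import Data.List.Properties
  using (++-assoc; ++-cancelˡ; ++-identityʳ; ∷-injectiveˡ; ∷-injectiveʳ; filter-all; length-++; length-map; ≡-dec)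
open import Data.List.Relation.Binary.Lex.Strict
  using (Lex-≤; base; this; next) renaming (≤-isDecTotalOrder to Lex-≤-isDecTotalOrder)
open import Data.List.Relation.Binary.Pointwise using (Pointwise-≡⇒≡; ≡⇒Pointwise-≡)
import Data.List.Relation.Binary.Prefix.Heterogeneous as Prefix
import Data.List.Relation.Binary.Suffix.Heterogeneous as Suffix
open import Data.List.Relation.Unary.All using (All; []; _∷_)
import Data.List.Relation.Unary.All as All
open import Data.List.Relation.Unary.AllPairs using ([]; _∷_)
open import Data.List.Relation.Unary.Any using (here; there; index)
open import Data.List.Relation.Unary.Any.Properties using (lookup-index)
open import Data.List.Relation.Unary.Unique.Propositional using (Unique)
open import Data.List.Relation.Unary.Unique.Propositional.Properties using (filter⁺; map⁺; upTo⁺)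
open import Data.Nat
open import Data.Nat.Divisibility using (divides; m∣m*n; ∣-trans; m≤n⇒m!∣n!)
open import Data.Nat.Properties
open import Data.Product using (∃-syntax; _×_; _,_; proj₁; proj₂)
open import Data.Sum using (_⊎_; inj₁; inj₂)
open import Function using (_∘_)
open import Function.Bundles using (_↔_; _⇔_; mk⇔; Equivalence; Injection)
open import Function.Properties.Inverse using (↔⇒↣)
open import Level using (0ℓ)
open import Relation.Binary using (IsDecTotalOrder; IsStrictTotalOrder; tri<; tri≈; tri>)
open import Relation.Binary.Construct.Flip.EqAndOrd using (isStrictTotalOrder)
open import Relation.Binary.PropositionalEquality
open import Relation.Nullary using (¬_; Dec; yes; no; contradiction; ¬?)
open import Relation.Nullary.Decidable using (map′; _×-dec_; via-injection)
open import Relation.Unary using (Pred; Decidable; _∩_)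

-- Factors given by position and length, and squares.

factor : {A : Set} → InfWord A → ℕ → ℕ → Word A
factor x s zero    = []
factor x s (suc n) = x s ∷ factor x (suc s) n

module _ {A : Set} (x : InfWord A) where

  length-factor : ∀ s n → length (factor x s n) ≡ n
  length-factor s zero    = refl
  length-factor s (suc n) = cong suc (length-factor (suc s) n)

  factor-++ : ∀ s m n → factor x s (m + n) ≡ factor x s m ++ factor x (s + m) n
  factor-++ s zero    n = cong (λ t → factor x t n) (sym (+-identityʳ s))
  factor-++ s (suc m) n = cong (x s ∷_)
    (trans (factor-++ (suc s) m n)
           (cong (λ t → factor x (suc s) m ++ factor x t n) (sym (+-suc s m))))

  factor-cong : ∀ n {s t} → (∀ i → i < n → x (s + i) ≡ x (t + i)) → factor x s n ≡ factor x t n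
  factor-cong zero    eq = refl
  factor-cong (suc n) {s} {t} eq = cong₂ _∷_
    (subst₂ (λ a b → x a ≡ x b) (+-identityʳ s) (+-identityʳ t) (eq 0 z<s))
    (factor-cong n λ i i<n →
      subst₂ (λ a b → x a ≡ x b) (+-suc s i) (+-suc t i) (eq (suc i) (s<s i<n)))

  factor-lookup : ∀ n {s t} → factor x s n ≡ factor x t n → ∀ i → i < n → x (s + i) ≡ x (t + i)
  factor-lookup (suc n) {s} {t} eq zero    _ =
    subst₂ (λ a b → x a ≡ x b) (sym (+-identityʳ s)) (sym (+-identityʳ t)) (∷-injectiveˡ eq)
  factor-lookup (suc n) {s} {t} eq (suc i) (s<s i<n) =
    subst₂ (λ a b → x a ≡ x b) (sym (+-suc s i)) (sym (+-suc t i))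
      (factor-lookup n (∷-injectiveʳ eq) i i<n)

  -- Centred at the cut just before position j.
  Square : ℕ → ℕ → Set
  Square j p = ∃[ q ] q + p ≡ j × (∀ i → i < p → x (q + i) ≡ x (j + i))

-- Lexicographic order and maximal suffixes of a window.

module Lexicographic {A : Set} {_≺_ : A → A → Set} (sto : IsStrictTotalOrder _≡_ _≺_) (x : InfWord A) where

  open IsStrictTotalOrder sto using (irrefl)
  private module ⊑ = IsDecTotalOrder (Lex-≤-isDecTotalOrder sto)

  infix 4 _⊑_

  _⊑_ : Word A → Word A → Set
  _⊑_ = Lex-≤ _≡_ _≺_

  ⊑-cancelˡ : ∀ r {u v} → r ++ u ⊑ r ++ v → u ⊑ v
  ⊑-cancelˡ []      u⊑v          = u⊑v
  ⊑-cancelˡ (a ∷ r) (this a≺a)   = contradiction a≺a (irrefl refl)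
  ⊑-cancelˡ (a ∷ r) (next _ u⊑v) = ⊑-cancelˡ r u⊑v

  IsMaxSuffix : ℕ → ℕ → ℕ → ℕ → Set
  IsMaxSuffix s n a b =
    s ≤ a × a + b ≡ s + n ×
    (∀ c e → s ≤ c → c + e ≡ s + n → factor x c e ⊑ factor x a b)

  -- Induction on the length: without its first letter, the window keeps all its suffixes except
  -- itself, so only the whole window is left to compare with the maximum found so far.
  maxSuffix : ∀ s n → ∃[ a ] ∃[ b ] IsMaxSuffix s n a b
  maxSuffix s zero = s , 0 , ≤-refl , refl , λ
    { c zero    _   _  → base _
    ; c (suc e) s≤c eq → contradiction (trans eq (+-identityʳ s))
        (≢-sym (<⇒≢ (≤-<-trans s≤c (m<m+n c z<s)))) }
  maxSuffix s (suc n) with maxSuffix (suc s) n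
  ... | a , b , s<a , ab , max with ⊑.total (factor x s (suc n)) (factor x a b)
  ...   | inj₁ whole⊑ = a , b , <⇒≤ s<a , trans ab (sym (+-suc s n)) , bound
    where
    bound : ∀ c e → s ≤ c → c + e ≡ s + suc n → factor x c e ⊑ factor x a b
    bound c e s≤c eq with m≤n⇒m<n∨m≡n s≤c
    ... | inj₁ s<c  = max c e s<c (trans eq (+-suc s n))
    ... | inj₂ refl with refl ← +-cancelˡ-≡ s e (suc n) eq = whole⊑
  ...   | inj₂ ⊑whole = s , suc n , ≤-refl , refl , bound
    where
    bound : ∀ c e → s ≤ c → c + e ≡ s + suc n → factor x c e ⊑ factor x s (suc n)
    bound c e s≤c eq with m≤n⇒m<n∨m≡n s≤c
    ... | inj₁ s<c  = ⊑.trans (max c e s<c (trans eq (+-suc s n))) ⊑whole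
    ... | inj₂ refl with refl ← +-cancelˡ-≡ s e (suc n) eq = ⊑.refl

  -- A square r r centred at the maximal suffix v cannot start inside the window: then r v is
  -- a suffix, so r v ⊑ v. If v = r t, cancelling r gives v ⊑ t, although t is a shorter suffix;
  -- otherwise r = v z with z nonempty, and v is a proper prefix of r v = v z v.
  square-overflows : ∀ {s n a b} → IsMaxSuffix s n a b →
    ∀ {p} → 1 ≤ p → ((q , _) : Square x a p) → q < s
  square-overflows {s} {n} {a} {b} (_ , ab , max) {p} 1≤p (q , qp , sq) = ≰⇒> impossible
    where
    r = factor x a p
    v = factor x a b

    rv⊑v : s ≤ q → r ++ v ⊑ v
    rv⊑v s≤q = subst (_⊑ v)
      (trans (factor-++ x q p b)
             (cong₂ _++_ (factor-cong x p sq) (cong (λ t → factor x t b) qp)))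
      (max q (p + b) s≤q (trans (sym (+-assoc q p b)) (trans (cong (_+ b) qp) ab)))

    impossible : ¬ s ≤ q
    impossible s≤q with p ≤? b
    ... | yes p≤b with t , pt ← m≤n⇒∃[o]m+o≡n p≤b = <⇒≢ (m<n+m t 1≤p) (trans t≡b (sym pt))
      where
      v≡ : v ≡ r ++ factor x (a + p) t
      v≡ = trans (cong (factor x a) (sym pt)) (factor-++ x a p t)

      v⊑ : v ⊑ factor x (a + p) t
      v⊑ = ⊑-cancelˡ r (subst (r ++ v ⊑_) v≡ (rv⊑v s≤q))

      ⊑v : factor x (a + p) t ⊑ v
      ⊑v = max (a + p) t (≤-trans s≤q (≤-trans (m≤m+n q p) (≤-trans (≤-reflexive qp) (m≤m+n a p))))
        (trans (+-assoc a p t) (trans (cong (a +_) pt) ab))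

      t≡b : t ≡ b
      t≡b = trans (sym (length-factor x (a + p) t))
        (trans (cong length (Pointwise-≡⇒≡ (⊑.antisym ⊑v v⊑))) (length-factor x a b))
    ... | no p≰b with t , bt ← m≤n⇒∃[o]m+o≡n (≰⇒> p≰b) = ¬∷⊑[] z++v⊑[]
      where
      z = factor x (a + b) (suc t)

      r≡ : r ≡ v ++ z
      r≡ = trans (cong (factor x a) (trans (sym bt) (sym (+-suc b t)))) (factor-++ x a b (suc t))

      ¬∷⊑[] : ∀ {c u} → ¬ c ∷ u ⊑ []
      ¬∷⊑[] ()

      z++v⊑[] : z ++ v ⊑ []
      z++v⊑[] = ⊑-cancelˡ v (subst₂ _⊑_
        (trans (cong (_++ v) r≡) (++-assoc v z v)) (sym (++-identityʳ v)) (rv⊑v s≤q))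

-- The critical factorization theorem for a window of `x`.

module CriticalFactorization {A : Set} (x : InfWord A) (s L n : ℕ) (2L≤n : L + L ≤ n)
  (squares : ∀ j → s ≤ j → ∃[ p ] 1 ≤ p × p ≤ L × Square x j p) where

  WindowPeriod : ℕ → Set
  WindowPeriod p = ∀ i → s ≤ i → i + p < s + n → x (i + p) ≡ x i

  module _ {_≺_ : A → A → Set} (sto : IsStrictTotalOrder _≡_ _≺_) where

    private
      module ≺ = IsStrictTotalOrder sto
      module U = Lexicographic sto x
      module D = Lexicographic (isStrictTotalOrder sto) x

    -- At a first difference the letters would be in order both for `_≺_` and for its converse. So
    -- there is none, and since a nonempty word is never below the empty one, the first word is a
    -- prefix of the second.
    lex-agree : ∀ n m c e → factor x c n U.⊑ factor x e m → factor x c n D.⊑ factor x e m →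
      ∀ i → i < n → x (c + i) ≡ x (e + i)
    lex-agree (suc n) (suc m) c e (this c≺e) (this e≺c) i _ = contradiction e≺c (≺.asym c≺e)
    lex-agree (suc n) (suc m) c e (this c≺e) (next c≡e _) i _ = contradiction c≺e (≺.irrefl c≡e)
    lex-agree (suc n) (suc m) c e (next c≡e _) (this e≺c) i _ = contradiction e≺c (≺.irrefl (sym c≡e))
    lex-agree (suc n) (suc m) c e (next c≡e _) (next _ _) zero _ =
      subst₂ (λ a b → x a ≡ x b) (sym (+-identityʳ c)) (sym (+-identityʳ e)) c≡e
    lex-agree (suc n) (suc m) c e (next _ u) (next _ d) (suc i) (s<s i<n) =
      subst₂ (λ a b → x a ≡ x b) (sym (+-suc c i)) (sym (+-suc e i))
        (lex-agree n m (suc c) (suc e) u d i i<n)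

    -- With w = u v = u′ v′, v and v′ the maximal suffixes for the two orders and v′ = y v, the
    -- local period r at v has u as a suffix, so v = r t and y t is a suffix of w. Then t is
    -- below v for both orders, hence a prefix of v, and |r| is a period of w.
    critical : ∀ {a b a′ b′} → U.IsMaxSuffix s n a b → D.IsMaxSuffix s n a′ b′ → a′ ≤ a →
      ∃[ p ] 1 ≤ p × p ≤ L × WindowPeriod p
    critical {a} {b} {a′} {b′} maxU@(s≤a , ab , ⊑v) maxD@(s≤a′ , ab′ , ⊑v′) a′≤a
      with p , 1≤p , p≤L , square@(q , qp , sq) ← squares a s≤a
      with q<s ← U.square-overflows maxU 1≤p square
      -- The square at `a` starts before `s`, so `a` is less than `s + L`; in a window of length at
      -- least `L + L`, the suffix `v` then has room for a copy of `r`.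
      with t , pt ← m≤n⇒∃[o]m+o≡n {p} {b} (+-cancelˡ-≤ a p b (let open ≤-Reasoning in begin
             a + p       ≡⟨ cong (_+ p) qp ⟨
             q + p + p   ≤⟨ +-mono-≤ (+-mono-≤ (<⇒≤ q<s) p≤L) p≤L ⟩
             s + L + L   ≡⟨ +-assoc s L L ⟩
             s + (L + L) ≤⟨ +-monoʳ-≤ s 2L≤n ⟩
             s + n       ≡⟨ ab ⟨
             a + b       ∎))
      with y , ay ← m≤n⇒∃[o]m+o≡n a′≤a
      with r₁ , qr₁ ← m≤n⇒∃[o]m+o≡n (≤-trans (<⇒≤ q<s) s≤a′)
      = p , 1≤p , p≤L , period
      where
      -- Here `r₁` is the distance from `q` to `a′`, so the last `y` letters of the left copy of `r`
      -- are those between `a′` and `a`.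
      r₁y : r₁ + y ≡ p
      r₁y = +-cancelˡ-≡ q (r₁ + y) p
        (trans (sym (+-assoc q r₁ y)) (trans (cong (_+ y) qr₁) (trans ay (sym qp))))

      v′≡ : factor x a′ b′ ≡ factor x a′ y ++ factor x a b
      v′≡ = trans
        (cong (factor x a′) (+-cancelˡ-≡ a′ b′ (y + b)
          (trans ab′ (trans (sym ab) (trans (cong (_+ b) (sym ay)) (+-assoc a′ y b))))))
        (trans (factor-++ x a′ y b) (cong (λ c → factor x a′ y ++ factor x c b) ay))

      -- Shifted by `p`, the same `y` letters end the right copy of `r`, just before `t`. The suffix
      -- at `a + r₁` thus begins like `v′`, and this common beginning can be cancelled.
      yt≡ : factor x (a + r₁) (y + t) ≡ factor x a′ y ++ factor x (a + p) t
      yt≡ = trans (factor-++ x (a + r₁) y t)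
        (cong₂ _++_
          (factor-cong x y λ i i<y → sym (trans
            (cong x (trans (cong (_+ i) (sym qr₁)) (+-assoc q r₁ i)))
            (trans (sq (r₁ + i) (subst (r₁ + i <_) r₁y (+-monoʳ-< r₁ i<y)))
                   (cong x (sym (+-assoc a r₁ i))))))
          (cong (λ c → factor x c t) (trans (+-assoc a r₁ y) (cong (a +_) r₁y))))

      t⊑v : factor x (a + p) t U.⊑ factor x a b
      t⊑v = ⊑v (a + p) t (≤-trans s≤a (m≤m+n a p)) (trans (+-assoc a p t) (trans (cong (a +_) pt) ab))

      t⊒v : factor x (a + p) t D.⊑ factor x a b
      t⊒v = D.⊑-cancelˡ (factor x a′ y) (subst₂ D._⊑_ yt≡ v′≡
        (⊑v′ (a + r₁) (y + t) (≤-trans s≤a (m≤m+n a r₁))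
          (trans (+-assoc a r₁ (y + t))
            (trans (cong (a +_) (trans (sym (+-assoc r₁ y t)) (trans (cong (_+ t) r₁y) pt))) ab))))

      period : WindowPeriod p
      period i s≤i i+p<end with i <? a
      -- As `q < s`, the position `i` lies in the left copy of `r`.
      ... | yes i<a with k , qk ← m≤n⇒∃[o]m+o≡n (≤-trans (<⇒≤ q<s) s≤i) =
        trans (cong x i+p≡a+k) (trans (sym (sq k k<p)) (cong x qk))
        where
        k<p : k < p
        k<p = +-cancelˡ-< q k p (subst₂ _<_ (sym qk) (sym qp) i<a)

        i+p≡a+k : i + p ≡ a + k
        i+p≡a+k = trans (cong (_+ p) (sym qk)) (trans (+-assoc q k p)
          (trans (cong (q +_) (+-comm k p)) (trans (sym (+-assoc q p k)) (cong (_+ k) qp))))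
      -- From `a` on, `i + p` lies in `t`, which is a prefix of `v`.
      ... | no i≮a with k , ak ← m≤n⇒∃[o]m+o≡n (≮⇒≥ i≮a) =
        trans (cong x i+p≡a+p+k) (trans (lex-agree t b (a + p) a t⊑v t⊒v k k<t) (cong x ak))
        where
        i+p≡a+p+k : i + p ≡ a + p + k
        i+p≡a+p+k = trans (cong (_+ p) (sym ak)) (trans (+-assoc a k p)
          (trans (cong (a +_) (+-comm k p)) (sym (+-assoc a p k))))

        k<t : k < t
        k<t = +-cancelˡ-< (a + p) k t (subst₂ _<_ i+p≡a+p+k
          (trans (sym ab) (trans (cong (a +_) (sym pt)) (sym (+-assoc a p t)))) i+p<end)

  window-period : {_≺_ : A → A → Set} → IsStrictTotalOrder _≡_ _≺_ →
    ∃[ p ] 1 ≤ p × p ≤ L × WindowPeriod p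
  window-period sto
    with a  , _ , maxU ← Lexicographic.maxSuffix sto x s n
    with a′ , _ , maxD ← Lexicographic.maxSuffix (isStrictTotalOrder sto) x s n
    with ≤-total a′ a
  ... | inj₁ a′≤a = critical sto maxU maxD a′≤a
  -- Flipping twice restores the order, so the two suffixes merely exchange roles.
  ... | inj₂ a≤a′ = critical (isStrictTotalOrder sto) maxD maxU a≤a′

-- From bounded squares to ultimate periodicity.

squares⇒periodic : ∀ {A : Set} {_≺_ : A → A → Set} → IsStrictTotalOrder _≡_ _≺_ →
  (x : InfWord A) (s L : ℕ) → (∀ j → s ≤ j → ∃[ p ] 1 ≤ p × p ≤ L × Square x j p) →
  IsUltimatelyPeriodic x
-- The period found may change with the window, but it is at most `L`, so it divides `L !`, which
-- serves all windows at once.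
squares⇒periodic sto x s L squares = L ! , 1≤n! L , s , periodic
  where
  iterate-period : ∀ {p} i M → s ≤ i → (∀ j → s ≤ j → j + p < M → x (j + p) ≡ x j) →
    ∀ k → i + k * p < M → x (i + k * p) ≡ x i
  iterate-period i M s≤i per zero lt = cong x (+-identityʳ i)
  iterate-period {p} i M s≤i per (suc k) lt =
    trans (cong x shift) (trans
      (per (i + k * p) (≤-trans s≤i (m≤m+n i (k * p))) (subst (_< M) shift lt))
      (iterate-period i M s≤i per k
        (≤-<-trans (+-monoʳ-≤ i (m≤n+m (k * p) p)) lt)))
    where
    shift : i + (p + k * p) ≡ i + k * p + p
    shift = trans (cong (i +_) (+-comm p (k * p))) (sym (+-assoc i (k * p) p))

  periodic : ∀ i → s ≤ i → x (i + L !) ≡ x i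
  periodic i s≤i
    -- `L + L` meets the length condition of the factorization theorem; the other summand carries
    -- the window past `i + L !`.
    with n ← L + L + suc (i + L !) in n≡
    with suc p , _ , p<L , per ← CriticalFactorization.window-period x s L n
           (subst (L + L ≤_) n≡ (m≤m+n (L + L) _)) squares sto
    with divides k L!≡kp ← ∣-trans (m∣m*n {suc p} (p !)) (m≤n⇒m!∣n! p<L) =
      subst (λ m → x (i + m) ≡ x i) (sym L!≡kp)
        (iterate-period i (s + n) s≤i per k
          (≤-trans (≤-trans (≤-reflexive (cong (λ m → suc (i + m)) (sym L!≡kp)))
            (≤-trans (m≤n+m _ (L + L)) (≤-reflexive n≡))) (m≤n+m n s)))

-- Counting with lists without repetition.

module _ {B : Set} where

  unique-⊆⇒length≤ : ∀ {as bs : List B} → Unique as → (∀ {a} → a ∈ as → a ∈ bs) → length as ≤ length bs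
  unique-⊆⇒length≤ []            _     = z≤n
  unique-⊆⇒length≤ {a ∷ as} (a∉as ∷ u) as⊆bs
    with ys , zs , refl ← ∈-∃++ (as⊆bs (here refl)) =
    subst (suc (length as) ≤_)
      (trans (sym (+-suc (length ys) (length zs))) (sym (length-++ ys)))
      (s≤s (subst (length as ≤_) (length-++ ys) (unique-⊆⇒length≤ u as⊆rest)))
    where
    as⊆rest : ∀ {c} → c ∈ as → c ∈ ys ++ zs
    as⊆rest c∈as with ∈-++⁻ ys (as⊆bs (there c∈as))
    ... | inj₁ c∈ys         = ∈-++⁺ˡ c∈ys
    ... | inj₂ (here refl)  = contradiction refl (All.lookup a∉as c∈as)
    ... | inj₂ (there c∈zs) = ∈-++⁺ʳ ys c∈zs

  HasCard-≤ : ∀ {S : Pred B 0ℓ} {m n} → HasCard S m → HasCard S n → m ≤ n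
  HasCard-≤ (as , ua , refl , as⇔) (bs , ub , refl , bs⇔) =
    unique-⊆⇒length≤ ua λ {a} → Equivalence.from (bs⇔ a) ∘ Equivalence.to (as⇔ a)

  lookup-distinct : ∀ {as : List B} → Unique as → ∀ {i j} → i Fin.< j → lookup as i ≢ lookup as j
  lookup-distinct (a∉as ∷ _) {Fin.zero}  {Fin.suc j} _         = All.lookup a∉as (∈-lookup j)
  lookup-distinct (_ ∷ u)    {Fin.suc i} {Fin.suc j} (s<s i<j) = lookup-distinct u i<j

  -- After a rejected element everything is kept: a second rejected one would equal the first,
  -- against `Unique`.
  length-filter-reject≤1 : ∀ {P : Pred B 0ℓ} (P? : Decidable P) {as} → Unique as →
    (∀ {a b} → a ∈ as → b ∈ as → ¬ P a → ¬ P b → a ≡ b) → length as ≤ suc (length (filter P? as))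
  length-filter-reject≤1 P? {[]}     _          _   = z≤n
  length-filter-reject≤1 P? {a ∷ as} (a∉as ∷ u) one with P? a
  ... | yes _  = s≤s (length-filter-reject≤1 P? u λ b∈ c∈ → one (there b∈) (there c∈))
  ... | no ¬Pa = s≤s (≤-reflexive (cong length (sym (filter-all P? (All.tabulate P-rest)))))
    where
    P-rest : ∀ {b} → b ∈ as → _
    P-rest {b} b∈as with P? b
    ... | yes Pb = Pb
    ... | no ¬Pb = contradiction (one (here refl) (there b∈as) ¬Pa ¬Pb) (All.lookup a∉as b∈as)

  -- `f` takes the membership proof because the word later attached to an end is computed from that
  -- proof.
  pigeonhole-∈ : ∀ {C : Set} {as : List B} {cs : List C} (f : ∀ {a} → a ∈ as → C) →
    Unique as → (∀ {a} (a∈ : a ∈ as) → f a∈ ∈ cs) → length cs < length as →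
    ∃[ a ] ∃[ b ] ∃[ a∈ ] ∃[ b∈ ] (a ≢ b × f {a} a∈ ≡ f {b} b∈)
  pigeonhole-∈ {as = as} {cs} f u f∈ cs<as
    with i , j , i<j , eq ← Fin.pigeonhole cs<as (λ i → index (f∈ (∈-lookup {xs = as} i))) =
    _ , _ , ∈-lookup i , ∈-lookup j , lookup-distinct u i<j ,
    trans (lookup-index (f∈ (∈-lookup i)))
      (trans (cong (lookup cs) eq) (sym (lookup-index (f∈ (∈-lookup j)))))

-- Prefixes, suffixes and occurrences in an infinite word.

module _ {A : Set} where

  ++-IsPrefix : ∀ (u : Word A) {v} → IsPrefix u (u ++ v)
  ++-IsPrefix u = Prefix.fromView (≡⇒Pointwise-≡ refl Prefix.++ _)

  ++-IsSuffix : ∀ (u : Word A) {v} → IsSuffix v (u ++ v)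
  ++-IsSuffix u = Suffix.fromView (u Suffix.++ ≡⇒Pointwise-≡ refl)

  IsPrefix⇒++ : ∀ {u v : Word A} → IsPrefix u v → ∃[ t ] v ≡ u ++ t
  IsPrefix⇒++ p with eq Prefix.++ t ← Prefix.toView p = t , cong (_++ t) (sym (Pointwise-≡⇒≡ eq))

  IsSuffix⇒++ : ∀ {u v : Word A} → IsSuffix u v → ∃[ t ] v ≡ t ++ u
  IsSuffix⇒++ p with t Suffix.++ eq ← Suffix.toView p = t , cong (t ++_) (sym (Pointwise-≡⇒≡ eq))

  ++-comparable : ∀ (u v : Word A) {r s} → u ++ r ≡ v ++ s → (∃[ t ] v ≡ u ++ t) ⊎ (∃[ t ] u ≡ v ++ t)
  ++-comparable []      v       eq = inj₁ (v , refl)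
  ++-comparable (a ∷ u) []      eq = inj₂ (a ∷ u , refl)
  ++-comparable (a ∷ u) (b ∷ v) eq with refl ← ∷-injectiveˡ eq with ++-comparable u v (∷-injectiveʳ eq)
  ... | inj₁ (t , v≡) = inj₁ (t , cong (a ∷_) v≡)
  ... | inj₂ (t , u≡) = inj₂ (t , cong (a ∷_) u≡)

module _ {A : Set} (x : InfWord A) where

  factor-++ω : ∀ s n {y : InfWord A} → (∀ i → x (s + n + i) ≡ y i) →
    ∀ i → x (s + i) ≡ (factor x s n ++ω y) i
  factor-++ω s zero    eq i       = trans (cong (λ t → x (t + i)) (sym (+-identityʳ s))) (eq i)
  factor-++ω s (suc n) eq zero    = cong x (+-identityʳ s)
  factor-++ω s (suc n) eq (suc i) = trans (cong x (+-suc s i))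
    (factor-++ω (suc s) n (λ j → trans (cong (λ t → x (t + j)) (sym (+-suc s n))) (eq j)) i)

  factor-++⁻ : ∀ s n u {v} → factor x s n ≡ u ++ v → length u ≤ n × u ≡ factor x s (length u)
  factor-++⁻ s n       []      eq = z≤n , refl
  factor-++⁻ s (suc n) (a ∷ u) eq with refl ← ∷-injectiveˡ eq
    with len≤ , u≡ ← factor-++⁻ (suc s) n u (∷-injectiveʳ eq) = s≤s len≤ , cong (a ∷_) u≡

  factor∈F : ∀ s n → F x (factor x s n)
  factor∈F s n = factor x 0 s , _ , factor-++ω 0 s (factor-++ω s n λ _ → refl)

  ++ω-factor : ∀ w {y : InfWord A} s → (∀ i → x (s + i) ≡ (w ++ω y) i) → w ≡ factor x s (length w)
  ++ω-factor []      s eq = refl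
  ++ω-factor (a ∷ w) s eq = cong₂ _∷_ (trans (sym (eq 0)) (cong x (+-identityʳ s)))
    (++ω-factor w (suc s) λ i → trans (cong x (sym (+-suc s i))) (eq (suc i)))

  drop-++ω : ∀ u {y : InfWord A} s → (∀ i → x (s + i) ≡ (u ++ω y) i) →
    ∀ i → x (s + length u + i) ≡ y i
  drop-++ω []      s eq i = trans (cong (λ t → x (t + i)) (+-identityʳ s)) (eq i)
  drop-++ω (a ∷ u) s eq i = trans (cong (λ t → x (t + i)) (+-suc s (length u)))
    (drop-++ω u (suc s) (λ j → trans (cong x (sym (+-suc s j))) (eq (suc j))) i)

  F⇒factor : ∀ s {w} → F (λ i → x (s + i)) w → ∃[ t ] w ≡ factor x (s + t) (length w)
  F⇒factor s {w} (u , y , eq) = length u , ++ω-factor w (s + length u) (drop-++ω u s eq)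

  -- The two occurrences give the period `p`, the distance from `a` to `a′`, on the stretch from `a`
  -- to `a′ + b`. The bounds on `j` say that this stretch contains the `p` letters on either side of
  -- the cut.
  overlap⇒Square : ∀ {a a′ b j L} → a < a′ → a′ ≤ j → j ≤ a + b → b ≤ L →
    factor x a b ≡ factor x a′ b → ∃[ p ] 1 ≤ p × p ≤ L × Square x j p
  overlap⇒Square {a} {a′} {b} {j} a<a′ a′≤j j≤a+b b≤L eq
    with p , refl ← m≤n⇒∃[o]m+o≡n (<⇒≤ a<a′)
    with k , refl ← m≤n⇒∃[o]m+o≡n a′≤j =
    p , +-cancelˡ-< a 0 p (subst (_< a + p) (sym (+-identityʳ a)) a<a′) ,
    ≤-trans (+-cancelˡ-≤ a p b (≤-trans a′≤j j≤a+b)) b≤L ,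
    a + k , swap , λ i i<p → trans (cong x (+-assoc a k i))
      (trans (factor-lookup x b eq (k + i)
               (+-cancelˡ-< a (k + i) b (<-≤-trans (subst₂ _<_ (+-assoc a k i) swap (+-monoʳ-< (a + k) i<p)) j≤a+b)))
             (cong x (sym (+-assoc (a + p) k i))))
    where
    swap : ∀ {p k} → a + k + p ≡ a + p + k
    swap {p} {k} = trans (+-assoc a k p) (trans (cong (a +_) (+-comm k p)) (sym (+-assoc a p k)))

-- Prefix codes and uniqueness of factorizations.

module PrefixCode {A : Set} {X : Language A}
  (nonempty : ∀ {w} → X w → w ≢ []) (prefix : ∀ {u v} → X u → X v → ¬ IsProperPrefix u v) where

  prefix-++ : ∀ u {t} → X u → X (u ++ t) → t ≡ []
  prefix-++ u {[]}    Xu Xut = refl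
  prefix-++ u {a ∷ t} Xu Xut = contradiction
    (++-IsPrefix u , λ u≡ → contradiction (++-cancelˡ u [] (a ∷ t) (trans (++-identityʳ u) u≡)) λ ())
    (prefix Xu Xut)

  first-unique : ∀ w w′ {r r′} → X w → X w′ → w ++ r ≡ w′ ++ r′ → w ≡ w′
  first-unique w w′ Xw Xw′ eq with ++-comparable w w′ eq
  ... | inj₁ (t , refl) = trans (sym (++-identityʳ w)) (cong (w ++_) (sym (prefix-++ w Xw Xw′)))
  ... | inj₂ (t , refl) = trans (cong (w′ ++_) (prefix-++ w′ Xw′ Xw)) (++-identityʳ w′)

  -- In a prefix code both factorizations start with the same word, which is cancelled. When one
  -- runs out, so does the other, as the remainder has no prefix in `X`.
  star-remainder-unique : ∀ {ws ws′} {u u′ : Word A} → All X ws → All X ws′ →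
    (∀ {p} → IsPrefix p u → ¬ X p) → (∀ {p} → IsPrefix p u′ → ¬ X p) →
    concat ws ++ u ≡ concat ws′ ++ u′ → concat ws ≡ concat ws′ × u ≡ u′
  star-remainder-unique [] [] _ _ eq = refl , eq
  star-remainder-unique {ws′ = w ∷ ws′} {u′ = u′} [] (Xw ∷ _) noPre _ refl = contradiction Xw
    (noPre (subst (IsPrefix w) (sym (++-assoc w (concat ws′) u′)) (++-IsPrefix w)))
  star-remainder-unique {w ∷ ws} {u = u} (Xw ∷ _) [] _ noPre refl = contradiction Xw
    (noPre (subst (IsPrefix w) (sym (++-assoc w (concat ws) u)) (++-IsPrefix w)))
  star-remainder-unique {w ∷ ws} {w′ ∷ ws′} {u} {u′} (Xw ∷ Xws) (Xw′ ∷ Xws′) noPre noPre′ eq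
    with eq′ ← trans (sym (++-assoc w _ u)) (trans eq (++-assoc w′ _ u′))
    with refl ← first-unique w w′ Xw Xw′ eq′
    with rest , u≡u′ ← star-remainder-unique Xws Xws′ noPre noPre′ (++-cancelˡ w _ _ eq′) =
    cong (w ++_) rest , u≡u′

  -- Parses of the factors of `x`, counted by positions.

  module Parses (x : InfWord A) (X? : ∀ s n → Dec (X (factor x s n))) where

    factor-prefix : ∀ {s m n} → X (factor x s m) → X (factor x s n) → m ≤ n → m ≡ n
    factor-prefix {s} {m} Xm Xn m≤n with t , refl ← m≤n⇒∃[o]m+o≡n m≤n =
      trans (sym (+-identityʳ m)) (cong (m +_) (trans
        (cong length (sym (prefix-++ (factor x s m) Xm (subst X (factor-++ x s m t) Xn))))
        (length-factor x (s + m) t)))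

    -- For `e` equal to `s + i` this means that `factor x s i` has a suffix in `X`. Using positions
    -- makes ends comparable when `s` moves.
    HasEnd : ℕ → ℕ → Set
    HasEnd s e = ∃[ a ] ∃[ b ] s ≤ a × a + b ≡ e × X (factor x a b)

    hasEnd? : ∀ s e → Dec (HasEnd s e)
    hasEnd? s e = map′
      (λ { (a , s≤s a≤e , s≤a , Xab) → a , e ∸ a , s≤a , m+[n∸m]≡n a≤e , Xab })
      (λ { (a , b , s≤a , refl , Xab) → a , s≤s (m≤m+n a b) , s≤a ,
             subst (λ n → X (factor x a n)) (sym (m+n∸m≡n a b)) Xab })
      (anyUpTo? (λ a → (s ≤? a) ×-dec X? a (e ∸ a)) (suc e))

    Greedy : ℕ → ℕ → Set
    Greedy s n = ∃[ z ] ∃[ u ] factor x s n ≡ z ++ u × Star X z × (∀ {p} → IsPrefix p u → ¬ X p)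

    -- Words of `X` are removed from the front as long as there is one. They are nonempty, so the
    -- remaining length drops and the bound `k` can decrease with it.
    greedy′ : ∀ k s n → n ≤ k → Greedy s n
    greedy′ k s n n≤k with anyUpTo? (λ m → X? s m) (suc n)
    ... | no ¬X = [] , factor x s n , refl , ([] , [] , refl) , noPre
      where
      noPre : ∀ {p} → IsPrefix p (factor x s n) → ¬ X p
      noPre {p} p≤ Xp with _ , eq ← IsPrefix⇒++ p≤ with len≤ , p≡ ← factor-++⁻ x s n p eq =
        ¬X (length p , s≤s len≤ , subst X p≡ Xp)
    greedy′ k s n n≤k | yes (zero , _ , X[]) = contradiction refl (nonempty X[])
    greedy′ (suc k) s n n≤k | yes (suc m , s≤s m≤n , Xm) with n′ , refl ← m≤n⇒∃[o]m+o≡n m≤n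
      with z , u , eq , (ws , Xws , refl) , noPre ←
             greedy′ k (s + suc m) n′ (≤-trans (m≤n+m n′ m) (s≤s⁻¹ n≤k)) =
      factor x s (suc m) ++ z , u ,
      trans (factor-++ x s (suc m) n′)
        (trans (cong (factor x s (suc m) ++_) eq) (sym (++-assoc (factor x s (suc m)) z u))) ,
      (factor x s (suc m) ∷ ws , Xm ∷ Xws , refl) , noPre
    greedy′ zero s zero n≤k | yes (suc m , s≤s () , Xm)

    greedy : ∀ s n → Greedy s n
    greedy s n = greedy′ n s n ≤-refl

    -- The lengths of the left components of the parses of factor x s n.
    cuts : ℕ → ℕ → List ℕ
    cuts s n = filter (λ i → ¬? (hasEnd? s (s + i))) (upTo (suc n))

    cuts-Unique : ∀ s n → Unique (cuts s n)
    cuts-Unique s n = filter⁺ (λ i → ¬? (hasEnd? s (s + i))) (upTo⁺ (suc n))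

    ∈-cuts⁺ : ∀ {s n i} → i ≤ n → ¬ HasEnd s (s + i) → i ∈ cuts s n
    ∈-cuts⁺ {s} i≤n = ∈-filter⁺ (λ i → ¬? (hasEnd? s (s + i))) (∈-upTo⁺ (s≤s i≤n))

    ∈-cuts⁻ : ∀ {s n i} → i ∈ cuts s n → i ≤ n × ¬ HasEnd s (s + i)
    ∈-cuts⁻ {s} {n} i∈ with i<n , ¬end ← ∈-filter⁻ (λ i → ¬? (hasEnd? s (s + i))) {xs = upTo (suc n)} i∈ =
      s≤s⁻¹ (∈-upTo⁻ i<n) , ¬end

    suffix⇔HasEnd : ∀ s i → HasEnd s (s + i) ⇔ (∃[ p ] IsSuffix p (factor x s i) × X p)
    suffix⇔HasEnd s i = mk⇔ to from
      where
      to : HasEnd s (s + i) → ∃[ p ] IsSuffix p (factor x s i) × X p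
      to (a , b , s≤a , a+b≡s+i , Xab) with c , refl ← m≤n⇒∃[o]m+o≡n s≤a
        with refl ← +-cancelˡ-≡ s (c + b) i (trans (sym (+-assoc s c b)) a+b≡s+i) =
        factor x (s + c) b ,
        subst (IsSuffix (factor x (s + c) b)) (sym (factor-++ x s c b)) (++-IsSuffix (factor x s c)) , Xab

      from : (∃[ p ] IsSuffix p (factor x s i) × X p) → HasEnd s (s + i)
      from (p , suf , Xp) with t , eq ← IsSuffix⇒++ suf
        with len≤ , t≡ ← factor-++⁻ x s i t eq
        with b , refl ← m≤n⇒∃[o]m+o≡n len≤ =
        s + length t , b , m≤m+n s (length t) , +-assoc s (length t) b ,
        subst X (++-cancelˡ t _ _ (trans (sym eq) (trans (factor-++ x s (length t) b)
          (cong (_++ factor x (s + length t) b) (sym t≡))))) Xp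

    parseAt : ℕ → ℕ → ℕ → Word A × Word A × Word A
    parseAt s n i with z , u , _ ← greedy (s + i) (n ∸ i) = factor x s i , z , u

    parseAt-injective : ∀ s n {i j} → parseAt s n i ≡ parseAt s n j → i ≡ j
    parseAt-injective s n {i} {j} eq = trans (sym (length-factor x s i))
      (trans (cong (length ∘ proj₁) eq) (length-factor x s j))

    parseAt-IsParse : ∀ {s n i} → i ∈ cuts s n → IsParse X (factor x s n) (parseAt s n i)
    parseAt-IsParse {s} {n} {i} i∈ with i≤n , ¬end ← ∈-cuts⁻ {s} {n} i∈
      with z , u , eq , star , noPre ← greedy (s + i) (n ∸ i) =
      trans (cong (factor x s) (sym (m+[n∸m]≡n i≤n)))
        (trans (factor-++ x s i (n ∸ i)) (cong (factor x s i ++_) eq)) ,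
      (λ suf Xp → ¬end (Equivalence.from (suffix⇔HasEnd s i) (_ , suf , Xp))) ,
      star , noPre

    -- What follows `v` is split by the parse and by `greedy` in the same way, by
    -- `star-remainder-unique`; so `v`, hence its length, determines the parse.
    IsParse⇒parseAt : ∀ {s n v z u} → IsParse X (factor x s n) (v , z , u) →
      length v ∈ cuts s n × (v , z , u) ≡ parseAt s n (length v)
    IsParse⇒parseAt {s} {n} {v} {z} {u} (eq , noSuf , (ws , Xws , refl) , noPre)
      with len≤ , v≡ ← factor-++⁻ x s n v eq
      with z′ , u′ , eq′ , (ws′ , Xws′ , refl) , noPre′ ← greedy (s + length v) (n ∸ length v)
      with z≡ , u≡ ← star-remainder-unique Xws Xws′ noPre noPre′ (trans (++-cancelˡ v _ _ (trans (sym eq)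
             (trans (cong (factor x s) (sym (m+[n∸m]≡n len≤))) (trans (factor-++ x s (length v) (n ∸ length v))
               (cong (_++ factor x (s + length v) (n ∸ length v)) (sym v≡)))))) eq′) =
      ∈-cuts⁺ len≤ ¬end , cong₂ _,_ v≡ (cong₂ _,_ z≡ u≡)
      where
      ¬end : ¬ HasEnd s (s + length v)
      ¬end end with p , suf , Xp ← Equivalence.to (suffix⇔HasEnd s (length v)) end =
        noSuf (subst (IsSuffix p) (sym v≡) suf) Xp

    δ-factor : ∀ s n → δ X (factor x s n) (length (cuts s n))
    δ-factor s n = map (parseAt s n) (cuts s n) , map⁺ (parseAt-injective s n) (cuts-Unique s n) ,
      length-map (parseAt s n) (cuts s n) , λ b → mk⇔ to from
      where
      to : ∀ {b} → b ∈ map (parseAt s n) (cuts s n) → IsParse X (factor x s n) b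
      to b∈ with i , i∈ , refl ← ∈-map⁻ (parseAt s n) b∈ = parseAt-IsParse {s} {n} i∈

      from : ∀ {b} → IsParse X (factor x s n) b → b ∈ map (parseAt s n) (cuts s n)
      from parse with i∈ , b≡ ← IsParse⇒parseAt {s} {n} parse =
        subst (_∈ map (parseAt s n) (cuts s n)) (sym b≡) (∈-map⁺ (parseAt s n) i∈)

    -- If w has the maximal number d of parses, extending w to the right creates no new parse, so
    -- every later position is the end of a word of X.
    later-HasEnd : ∀ {d s n} → (∀ {w m} → F x w → δ X w m → m ≤ d) → δ X (factor x s n) d →
      ∀ e → s + n < e → HasEnd s e
    later-HasEnd {d} {s} {n} bound δd e s+n<e with hasEnd? s e
    ... | yes end = end
    ... | no ¬end with i , refl ← m≤n⇒∃[o]m+o≡n (≤-trans (m≤m+n s n) (<⇒≤ s+n<e)) =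
      contradiction
        (≤-trans (unique-⊆⇒length≤ {as = i ∷ cuts s n} (i∉cuts ∷ cuts-Unique s n) ⊆cuts)
          (≤-trans (bound (factor∈F x s i) (δ-factor s i)) (HasCard-≤ δd (δ-factor s n))))
        (<-irrefl refl)
      where
      n<i : n < i
      n<i = +-cancelˡ-< s n i s+n<e

      i∉cuts : All (i ≢_) (cuts s n)
      i∉cuts = All.tabulate λ j∈ i≡j → <⇒≱ n<i (subst (_≤ n) (sym i≡j) (proj₁ (∈-cuts⁻ {s} {n} j∈)))

      ⊆cuts : ∀ {j} → j ∈ i ∷ cuts s n → j ∈ cuts s i
      ⊆cuts (here refl) = ∈-cuts⁺ ≤-refl ¬end
      ⊆cuts (there j∈) with j≤n , ¬endj ← ∈-cuts⁻ {s} {n} j∈ = ∈-cuts⁺ (≤-trans j≤n (<⇒≤ n<i)) ¬endj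

    -- Open ends and stability.

    -- A factor at `s` with `d` parses provides such positions; its length is forgotten, so that the
    -- starting point alone can be moved to the left.
    OpenEnds : ℕ → ℕ → Set
    OpenEnds d s = ∃[ es ] Unique es × d ≤ length es × (∀ {e} → e ∈ es → s ≤ e × ¬ HasEnd s e)

    δ⇒OpenEnds : ∀ {d s n} → δ X (factor x s n) d → OpenEnds d s
    δ⇒OpenEnds {d} {s} {n} δd = map (s +_) (cuts s n) ,
      map⁺ (λ {i} {j} → +-cancelˡ-≡ s i j) (cuts-Unique s n) ,
      subst (d ≤_) (sym (length-map (s +_) (cuts s n))) (HasCard-≤ δd (δ-factor s n)) , open-end
      where
      open-end : ∀ {e} → e ∈ map (s +_) (cuts s n) → s ≤ e × ¬ HasEnd s e
      open-end e∈ with i , i∈ , refl ← ∈-map⁻ (s +_) e∈ = m≤m+n s i , proj₂ (∈-cuts⁻ {s} {n} i∈)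

    -- Moving s one step to the left closes at most one end, since X is a prefix code, and s itself
    -- becomes open.
    OpenEnds-pred : ∀ {d s} → OpenEnds d (suc s) → OpenEnds d s
    OpenEnds-pred {d} {s} (es , u , d≤ , open-es) = s ∷ filter open? es ,
      All.tabulate s∉ ∷ filter⁺ open? u ,
      ≤-trans d≤ (length-filter-reject≤1 open? u one-closed) , open-ends
      where
      open? : ∀ e → Dec (¬ HasEnd s e)
      open? e = ¬? (hasEnd? s e)

      s∉ : ∀ {e} → e ∈ filter open? es → s ≢ e
      s∉ e∈ = <⇒≢ (proj₁ (open-es (proj₁ (∈-filter⁻ open? {xs = es} e∈))))

      closed : ∀ {e} → e ∈ es → ¬ ¬ HasEnd s e → ∃[ b ] s + b ≡ e × X (factor x s b)
      closed {e} e∈ ¬open with hasEnd? s e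
      ... | no ¬end = contradiction ¬end ¬open
      ... | yes (a , b , s≤a , ab , Xab) with m≤n⇒m<n∨m≡n s≤a
      ...   | inj₁ s<a  = contradiction (a , b , s<a , ab , Xab) (proj₂ (open-es e∈))
      ...   | inj₂ refl = b , ab , Xab

      one-closed : ∀ {e e′} → e ∈ es → e′ ∈ es → ¬ ¬ HasEnd s e → ¬ ¬ HasEnd s e′ → e ≡ e′
      one-closed e∈ e′∈ ¬open ¬open′ with b , refl , Xb ← closed e∈ ¬open
        with b′ , refl , Xb′ ← closed e′∈ ¬open′ with ≤-total b b′
      ... | inj₁ b≤b′ = cong (s +_) (factor-prefix Xb Xb′ b≤b′)
      ... | inj₂ b′≤b = cong (s +_) (sym (factor-prefix Xb′ Xb b′≤b))

      open-ends : ∀ {e} → e ∈ s ∷ filter open? es → s ≤ e × ¬ HasEnd s e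
      -- A word starting at or after `s` and ending at `s` would be empty.
      open-ends (here refl) = ≤-refl , λ
        { (a , zero , _ , _ , X[])   → nonempty X[] refl
        ; (a , suc b , s≤a , ab , _) → <⇒≢ (≤-<-trans s≤a (m<m+n a z<s)) (sym ab) }
      open-ends (there e∈) with e∈es , ¬end ← ∈-filter⁻ open? {xs = es} e∈ =
        <⇒≤ (proj₁ (open-es e∈es)) , ¬end

    OpenEnds-∸ : ∀ {d s} t → OpenEnds d (s + t) → OpenEnds d s
    OpenEnds-∸ {d} {s} zero    ends = subst (OpenEnds d) (+-identityʳ s) ends
    OpenEnds-∸ {d} {s} (suc t) ends = OpenEnds-∸ t (OpenEnds-pred (subst (OpenEnds d) (+-suc s t) ends))

    -- By stability the maximum `d` is still attained by a factor starting at some `s + t`; its open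
    -- ends are carried back to `s`.
    stable⇒OpenEnds : ∀ {d} → IsStable X x → IsDegree X (F x) d → ∀ s → OpenEnds d s
    stable⇒OpenEnds {d} stable deg s
      with (w , w∈F , δd) , _ ← Equivalence.from (stable (factor x 0 s) (λ i → x (s + i))
             (factor-++ω x 0 s λ _ → refl) d) deg
      with t , w≡ ← F⇒factor x s w∈F = OpenEnds-∸ t (δ⇒OpenEnds (subst (λ v → δ X v d) w≡ δd))

    -- d words of X start at or before j and end after j, and one more ends at j; as X has at most
    -- d words in F x, one of them occurs twice, at two positions whose distance is the period.
    touching-words⇒Square : ∀ {d s₀ j} (bs : List (Word A)) → length bs ≤ d →
      (∀ {a b} → X (factor x a b) → factor x a b ∈ bs) →
      OpenEnds d (suc j) → (∀ e → j ≤ e → HasEnd s₀ e) →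
      ∃[ p ] 1 ≤ p × p ≤ max 0 (map length bs) × Square x j p
    touching-words⇒Square {d} {s₀} {j} bs bs≤d ∈bs (es , u , d≤ , open-es) ends = square
      where
      Touching : ℕ → Set
      Touching e = ∃[ a ] ∃[ b ] a ≤ j × j ≤ e × a + b ≡ e × X (factor x a b)

      touching : ∀ {e} → e ∈ j ∷ es → Touching e
      touching (here refl) with a , b , _ , ab , Xab ← ends j ≤-refl =
        a , b , subst (a ≤_) ab (m≤m+n a b) , ≤-refl , ab , Xab
      touching {e} (there e∈) with j<e , ¬end ← open-es e∈
        with a , b , _ , ab , Xab ← ends e (<⇒≤ j<e) with a ≤? j
      ... | yes a≤j = a , b , a≤j , <⇒≤ j<e , ab , Xab
      -- A word of `X` starting after `j` cannot end at `e`, which is open for `suc j`.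
      ... | no  a≰j = contradiction (a , b , ≰⇒> a≰j , ab , Xab) ¬end

      word : ∀ {e} → e ∈ j ∷ es → Word A
      word e∈ with a , b , _ ← touching e∈ = factor x a b

      word∈bs : ∀ {e} (e∈ : e ∈ j ∷ es) → word e∈ ∈ bs
      word∈bs e∈ with a , b , _ , _ , _ , Xab ← touching e∈ = ∈bs Xab

      square : ∃[ p ] 1 ≤ p × p ≤ max 0 (map length bs) × Square x j p
      square
        with e , e′ , e∈ , e′∈ , e≢e′ , w≡ ← pigeonhole-∈ {as = j ∷ es} {cs = bs} word
               (All.tabulate (λ e∈ → <⇒≢ (proj₁ (open-es e∈))) ∷ u)
               word∈bs (s≤s (≤-trans bs≤d d≤))
        with a  , b  , a≤j  , j≤e  , refl , Xab ← touching e∈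
        with a′ , b′ , a′≤j , j≤e′ , refl , _   ← touching e′∈
        -- Equal words have equal lengths, so distinct ends force distinct starts.
        with refl ← trans (sym (length-factor x a b)) (trans (cong length w≡) (length-factor x a′ b′))
        with b≤ ← subst (_≤ max 0 (map length bs)) (length-factor x a b)
               (All.lookup (xs≤max 0 (map length bs)) (∈-map⁺ length (∈bs Xab)))
        with <-cmp a a′
      ... | tri≈ _ refl _ = contradiction refl e≢e′
      ... | tri< a<a′ _ _ = overlap⇒Square x a<a′ a′≤j j≤e b≤ w≡
      ... | tri> _ _ a′<a = overlap⇒Square x a′<a a≤j j≤e′ b≤ (sym w≡)

    stable⇒squares : ∀ {d} → IsStable X x → IsDegree X (F x) d →
      (bs : List (Word A)) → length bs ≤ d → (∀ {a b} → X (factor x a b) → factor x a b ∈ bs) →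
      ∃[ N ] (∀ j → N ≤ j → ∃[ p ] 1 ≤ p × p ≤ max 0 (map length bs) × Square x j p)
    stable⇒squares {d} stable deg@((w , w∈F , δd) , bound) bs bs≤d ∈bs
      with s₀ , w≡ ← F⇒factor x 0 w∈F =
      -- The successor is there because `later-HasEnd` speaks of ends strictly after the end of `w`.
      suc (s₀ + length w) , λ j N≤j → touching-words⇒Square {d} {s₀} {j} bs bs≤d ∈bs
        (stable⇒OpenEnds stable deg (suc j))
        λ e j≤e → later-HasEnd {d} {s₀} {length w} bound (subst (λ v → δ X v d) w≡ δd) e (≤-trans N≤j j≤e)

mainTheorem13 : ∀ {A : Set} {k : ℕ} → A ↔ Fin k →
    (X : Language A) → IsMaximalBifixCode X → IsThin X →
    (x : InfWord A) → IsStable X x →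
    (d : ℕ) → IsDegree X (F x) d →
    Card≤ (X ∩ F x) d →
    IsUltimatelyPeriodic x
mainTheorem13 {A} A↔Fin X maxBifix _ x stable d deg (m , (bs , _ , length-bs , bs⇔) , m≤d) =
  let N , squares = stable⇒squares stable deg bs (subst (_≤ d) (sym length-bs) m≤d) ∈bs
      -- The order on letters is that of `Fin k`: squares are transported along `to`, and the period
      -- comes back by injectivity.
      n , 1≤n , N′ , periodic = squares⇒periodic Fin.<-isStrictTotalOrder (λ i → to (x i)) N
        (max 0 (map length bs)) λ j N≤j →
          let p , 1≤p , p≤L , q , qp , sq = squares j N≤j
          in  p , 1≤p , p≤L , q , qp , λ i i<p → cong to (sq i i<p)
  in  n , 1≤n , N′ , λ i N′≤i → injective (periodic i N′≤i)
  where
  open Injection (↔⇒↣ A↔Fin) using (to; injective)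
  open IsBifixCode (IsMaximalBifixCode.isBifixCode maxBifix) using (nonempty; prefix)

  ∈bs : ∀ {s n} → X (factor x s n) → factor x s n ∈ bs
  ∈bs {s} {n} Xw = Equivalence.from (bs⇔ (factor x s n)) (Xw , factor∈F x s n)

  _≟ʷ_ : (u v : Word A) → Dec (u ≡ v)
  _≟ʷ_ = ≡-dec (via-injection (↔⇒↣ A↔Fin) Fin._≟_)

  -- On factors of `x`, membership in `X` is membership in the finite list `bs`.
  X? : ∀ s n → Dec (X (factor x s n))
  X? s n = map′ (λ w∈ → proj₁ (Equivalence.to (bs⇔ (factor x s n)) w∈)) ∈bs (_∈?_ _≟ʷ_ (factor x s n) bs)

  open PrefixCode.Parses nonempty prefix x X?
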